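{- Let $X$ be a finite set, let $\mathcal{C}^{\ast}$ be a target clustering of $X$, and let $\gamma$ be any natural clustering error (with respect to $\mathcal{C}^{\ast}$). Then for every clustering $\mathcal{C}$ of $X$, $$\gamma(\mathcal{C},\mathcal{C}^{\ast}) \ge \delta(\mathcal{C},\mathcal{C}^{\ast}),$$ where $\delta(\mathcal{C},\mathcal{C}^{\ast}) = \mathrm{dist}(\mathcal{C}^{\ast},\mathcal{C}) + \mathrm{dist}(\mathcal{C},\mathcal{C}^{\ast})$.
   Context: A clustering of a finite set $X$ is a partition of $X$ into nonempty clusters. The target (ground-truth) clustering is $\mathcal{C}^{\ast}=\{C^{\ast}_1,\dots,C^{\ast}_k\}$. For clusterings $\mathcal{C},\mathcal{C}'$ of $X$ define $\mathrm{dist}(\mathcal{C},\mathcal{C}')=\sum_{A\in\mathcal{C}}\big(|\{B\in\mathcal{C}': B\cap A\neq\emptyset\}|-1\big)$. For a proposed clustering $\mathcal{C}$, $\delta_u=\mathrm{dist}(\mathcal{C}^{\ast},\mathcal{C})$ is its underclustering error, $\delta_o=\mathrm{dist}(\mathcal{C},\mathcal{C}^{\ast})$ its overclustering error, and $\delta(\mathcal{C},\mathcal{C}^{\ast})=\delta_u+\delta_o$. A natural clustering error is a function $\gamma$ assigning to each clustering $\mathcal{C}$ of $X$ a nonnegative integer $\gamma(\mathcal{C},\mathcal{C}^{\ast})$ such that for every clustering $\mathcal{C}$: (1) if some cluster $C_i\in\mathcal{C}$ contains points of $C^{\ast}_j$ and points of some other target cluster, then the clustering obtained by replacing $C_i$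 with the two clusters $C_i\cap C^{\ast}_j$ and $C_i\setminus C^{\ast}_j$ has strictly smaller $\gamma$; (2) if two distinct clusters of $\mathcal{C}$ both contain only points from the same target cluster, then the clustering obtained by replacing them with their union has strictly smaller $\gamma$. -}

module Defs where

open import Data.Bool.Properties using () renaming (_≟_ to _≟ᵇ_)
open import Data.Fin.Subset
  using (Subset; _∈_; _⊆_; _∩_; _∪_; _─_; Nonempty; Empty)
open import Data.Fin.Subset.Properties using (nonempty?)
open import Data.List using (List; []; _∷_; _++_; filter; length; map)
open import Data.List.Relation.Binary.BagAndSetEquality using (_∼[_]_; set)
open import Data.List.Relation.Unary.All using (All)
open import Data.List.Relation.Unary.AllPairs using (AllPairs)
open import Data.List.Relation.Unary.Any using (Any)
open import Data.Nat using (ℕ; _+_; _∸_; _<_)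
open import Data.Nat.ListAction using (sum)
open import Data.Product using (∃-syntax; _×_)
open import Data.Vec.Properties using (≡-dec)
open import Relation.Binary.Definitions using (DecidableEquality)
open import Relation.Binary.PropositionalEquality using (_≡_; _≢_)
open import Relation.Nullary.Decidable using (¬?)
import Data.List.Membership.DecPropositional as DecMembership

_≟ˢ_ : ∀ {n} → DecidableEquality (Subset n)
_≟ˢ_ = ≡-dec _≟ᵇ_

module _ {n : ℕ} where
  open DecMembership (_≟ˢ_ {n}) public
    using () renaming (_∈_ to _∈ₗ_; _∈?_ to _∈ₗ?_)

-- Nonemptiness and pairwise disjointness together exclude repeated clusters,
-- so the list represents a set of clusters.
record Clustering (n : ℕ) : Set where
  field
    clusters : List (Subset n)
    nonempty : All Nonempty clusters
    disjoint : AllPairs (λ A B → Empty (A ∩ B)) clusters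
    covers   : ∀ x → Any (x ∈_) clusters

open Clustering public

-- Equality of clusterings as sets of clusters: the order of the list is
-- immaterial.
infix 4 _≋_
_≋_ : ∀ {n} → Clustering n → Clustering n → Set
C ≋ C′ = clusters C ∼[ set ] clusters C′

hits : ∀ {n} → Subset n → Clustering n → ℕ
hits A C = length (filter (λ B → nonempty? (B ∩ A)) (clusters C))

-- The truncated subtraction is exact: each cluster A of C is nonempty and C′
-- covers, so hits A C′ is at least 1.
dist : ∀ {n} → Clustering n → Clustering n → ℕ
dist C C′ = sum (map (λ A → hits A C′ ∸ 1) (clusters C))

δ : ∀ {n} → Clustering n → Clustering n → ℕ
δ C C* = dist C* C + dist C C*

replace : ∀ {n} → List (Subset n) → List (Subset n) → List (Subset n) → List (Subset n)
replace old new Cs = new ++ filter (λ D → ¬? (D ∈ₗ? old)) Cs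

-- C′ is the clustering obtained from C by replacing A with A ∩ T and A ─ T.
IsSplit : ∀ {n} → Clustering n → Subset n → Subset n → Clustering n → Set
IsSplit C A T C′ =
  clusters C′ ∼[ set ] replace (A ∷ []) ((A ∩ T) ∷ (A ─ T) ∷ []) (clusters C)

-- C′ is the clustering obtained from C by replacing A and B with A ∪ B.
IsMerge : ∀ {n} → Clustering n → Subset n → Subset n → Clustering n → Set
IsMerge C A B C′ =
  clusters C′ ∼[ set ] replace (A ∷ B ∷ []) ((A ∪ B) ∷ []) (clusters C)

record IsNaturalError {n : ℕ} (C* : Clustering n) (γ : Clustering n → ℕ) : Set where
  field
    -- γ is a function of the clustering, not of the list representing it.
    γ-cong : ∀ {C C′} → C ≋ C′ → γ C ≡ γ C′

    split-decreases : ∀ {C C′ A T} →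
      A ∈ₗ clusters C →
      T ∈ₗ clusters C* →
      Nonempty (A ∩ T) →
      (∃[ S ] S ∈ₗ clusters C* × S ≢ T × Nonempty (A ∩ S)) →
      IsSplit C A T C′ →
      γ C′ < γ C

    merge-decreases : ∀ {C C′ A B} →
      A ∈ₗ clusters C →
      B ∈ₗ clusters C →
      A ≢ B →
      (∃[ T ] T ∈ₗ clusters C* × A ⊆ T × B ⊆ T) →
      IsMerge C A B C′ →
      γ C′ < γ C

{-# OPTIONS --safe #-}

-- If δ(C, C*) is positive, some natural operation lowers it by at most one while
-- lowering γ by at least one: a cluster meeting two target clusters can be split,
-- and if there is none, a target cluster meeting two clusters contains both of
-- them, so they can be merged. Induction on γ then gives γ ≥ δ.

module Submission where

open import Defs
open import Data.Empty using (⊥-elim)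
open import Data.Fin using (Fin)
open import Data.Fin.Subset
  using (Subset; inside; outside; _∈_; _∉_; _⊆_; _∩_; _∪_; _─_; Nonempty; Empty)
open import Data.Fin.Subset.Properties
  using (nonempty?; _∈?_; ∩-comm; x∈p∩q⁺; x∈p∩q⁻; x∈p∪q⁺; x∈p∪q⁻;
         x∈p∧x∉q⇒x∈p─q; p─q⊆p; p∩q⊆p; p∩q⊆q)
open import Data.List using (List; []; _∷_; _++_; filter; length; map)
open import Data.List.Membership.Propositional.Properties
  using (∈-filter⁺; ∈-filter⁻; ∈-∃++)
open import Data.List.Properties
  using (filter-accept; filter-reject; filter-all; filter-none; filter-++)
open import Data.List.Relation.Binary.BagAndSetEquality using (bag-=⇒; ↭⇒∼bag)
open import Data.List.Relation.Binary.Permutation.Propositional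
  using (_↭_; ↭-sym; ↭-trans; ↭-prep; ↭⇒↭ₛ; module PermutationReasoning)
open import Data.List.Relation.Binary.Permutation.Propositional.Properties
  using (All-resp-↭; Any-resp-↭; ∈-resp-↭; shift; filter-↭; ↭-length; ++⁺ˡ; map⁺)
open import Data.List.Relation.Binary.Permutation.Setoid.Properties
  using (AllPairs-resp-↭)
open import Data.List.Relation.Unary.All as All using (All; []; _∷_)
open import Data.List.Relation.Unary.All.Properties using (¬Any⇒All¬)
open import Data.List.Relation.Unary.AllPairs as AllPairs using (AllPairs; []; _∷_)
open import Data.List.Relation.Unary.Any using (here; there; any?)
open import Data.List.Relation.Unary.Unique.Propositional using (Unique)
import Data.List.Relation.Unary.Unique.Propositional.Properties as Unique
import Data.List.Membership.Propositional as Membership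
open import Data.Nat using (ℕ; suc; _+_; _∸_; _≤_; _<_; _≥_; _≤?_; z≤n; s≤s; s≤s⁻¹)
open import Data.Nat.Induction using (<-wellFounded)
open import Data.Nat.ListAction using (sum)
open import Data.Nat.ListAction.Properties using (sum-↭)
open import Data.Nat.Properties
open import Data.Product using (∃-syntax; _×_; _,_)
open import Data.Sum using (_⊎_; inj₁; inj₂)
open import Data.Vec using ([]; _∷_; here; there)
open import Function using (_∘_)
open import Induction.WellFounded using (Acc; acc)
open import Level using (Level)
open import Relation.Binary.PropositionalEquality
  using (_≡_; _≢_; refl; sym; cong; cong₂; subst; resp₂; setoid)
open import Relation.Nullary using (¬_; yes; no; contradiction)
open import Relation.Nullary.Decidable using (¬?)
open import Relation.Unary using (Pred; Decidable)

private
  variable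
    n : ℕ
    a p q r : Level
    X : Set a

infix 4 _∈ˡ_
_∈ˡ_ : X → List X → Set _
_∈ˡ_ = Membership._∈_

-- Clusters form a list whose order is immaterial, so the ones being operated on are moved to the
-- head; the new clustering is then a cons onto the untouched rest.
toFront : ∀ {x : X} {xs} → x ∈ˡ xs → ∃[ ys ] xs ↭ x ∷ ys
toFront {x = x} x∈xs with ys , zs , refl ← ∈-∃++ x∈xs = ys ++ zs , shift x ys zs

-- Counting in lists and comparing sums.

module _ {X : Set a} {P : Pred X p} (P? : Decidable P) where

  count : List X → ℕ
  count xs = length (filter P? xs)

  count-↭ : ∀ {xs ys} → xs ↭ ys → count xs ≡ count ys
  count-↭ = ↭-length ∘ filter-↭ P?

  count-∷-≤ : ∀ x xs → count (x ∷ xs) ≤ suc (count xs)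
  count-∷-≤ x xs with P? x
  ... | yes _ = ≤-refl
  ... | no  _ = n≤1+n _

  count-≤-∷ : ∀ x xs → count xs ≤ count (x ∷ xs)
  count-≤-∷ x xs with P? x
  ... | yes _ = n≤1+n _
  ... | no  _ = ≤-refl

  count-accept : ∀ x xs → P x → count (x ∷ xs) ≡ suc (count xs)
  count-accept _ _ px = cong length (filter-accept P? px)

  count-reject : ∀ x xs → ¬ P x → count (x ∷ xs) ≡ count xs
  count-reject _ _ ¬px = cong length (filter-reject P? ¬px)

  count≤1⇒≡ : ∀ {xs x y} → count xs ≤ 1 → x ∈ˡ xs → y ∈ˡ xs → P x → P y → x ≡ y
  count≤1⇒≡ {xs} c≤1 x∈ y∈ px py
    with filter P? xs | ∈-filter⁺ P? x∈ px | ∈-filter⁺ P? y∈ py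
  ... | _ ∷ []    | here refl | here refl = refl
  ... | _ ∷ _ ∷ _ | _         | _         = contradiction c≤1 λ { (s≤s ()) }

  2≤count⇒∃₂ : ∀ {xs} → Unique xs → 2 ≤ count xs →
    ∃[ x ] ∃[ y ] (x ∈ˡ xs × P x) × (y ∈ˡ xs × P y) × x ≢ y
  2≤count⇒∃₂ {xs} uniq 2≤c
    -- `∈-filter⁻` is abstracted together with the filtered list, so that after the match `from`
    -- applies to its first two entries.
    with filter P? xs | Unique.filter⁺ P? uniq | (λ {v} → ∈-filter⁻ P? {v} {xs})
  ... | x ∷ y ∷ _ | (x≢y ∷ _) ∷ _ | from =
    x , y , from (here refl) , from (there (here refl)) , x≢y
  ... | []     | _ | _ = contradiction 2≤c λ ()
  ... | _ ∷ [] | _ | _ = contradiction 2≤c λ { (s≤s ()) }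

module _ {X : Set a} {P : Pred X p} {Q : Pred X q} {R : Pred X r}
         (P? : Decidable P) (Q? : Decidable Q) (R? : Decidable R) where

  count-⊎ : (∀ {x} → P x → Q x ⊎ R x) → ∀ xs → count P? xs ≤ count Q? xs + count R? xs
  count-⊎ P⇒Q⊎R []       = z≤n
  count-⊎ P⇒Q⊎R (x ∷ xs) with P? x
  ... | no  _  = ≤-trans (count-⊎ P⇒Q⊎R xs) (+-mono-≤ (count-≤-∷ Q? x xs) (count-≤-∷ R? x xs))
  ... | yes px with P⇒Q⊎R px
  ...   | inj₁ qx rewrite filter-accept Q? {xs = xs} qx =
    s≤s (≤-trans (count-⊎ P⇒Q⊎R xs) (+-monoʳ-≤ (count Q? xs) (count-≤-∷ R? x xs)))
  ...   | inj₂ rx rewrite filter-accept R? {xs = xs} rx | +-suc (count Q? (x ∷ xs)) (count R? xs) =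
    s≤s (≤-trans (count-⊎ P⇒Q⊎R xs) (+-monoˡ-≤ (count R? xs) (count-≤-∷ Q? x xs)))

module _ {X : Set a} {f g : X → ℕ} where

  sum-map-mono : ∀ xs → (∀ {x} → x ∈ˡ xs → f x ≤ g x) → sum (map f xs) ≤ sum (map g xs)
  sum-map-mono []       f≤g = z≤n
  sum-map-mono (x ∷ xs) f≤g = +-mono-≤ (f≤g (here refl)) (sum-map-mono xs (f≤g ∘ there))

  -- Uniqueness makes the exceptional `y` occur only once, so its slack of 1 is paid only once.
  sum-map-mono-but-one : ∀ {y xs} → Unique xs → f y ≤ suc (g y) →
    (∀ {x} → x ∈ˡ xs → x ≢ y → f x ≤ g x) → y ∈ˡ xs →
    sum (map f xs) ≤ suc (sum (map g xs))
  sum-map-mono-but-one (y≢xs ∷ _) fy≤ f≤g (here refl) =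
    +-mono-≤ fy≤ (sum-map-mono _ λ x∈xs → f≤g (there x∈xs) (All.lookup y≢xs x∈xs ∘ sym))
  sum-map-mono-but-one {xs = x ∷ xs} (x≢xs ∷ uniq) fy≤ f≤g (there y∈xs) = begin
    f x + sum (map f xs)       ≤⟨ +-mono-≤ (f≤g (here refl) (All.lookup x≢xs y∈xs))
                                    (sum-map-mono-but-one uniq fy≤ (f≤g ∘ there) y∈xs) ⟩
    g x + suc (sum (map g xs)) ≡⟨ +-suc (g x) _ ⟩
    suc (g x + sum (map g xs)) ∎
    where open ≤-Reasoning

sum-map-0 : ∀ {f : X → ℕ} {xs} → All (λ x → f x ≡ 0) xs → sum (map f xs) ≡ 0
sum-map-0 []         = refl
sum-map-0 (eq ∷ eqs) = cong₂ _+_ eq (sum-map-0 eqs)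

-- Disjoint subsets and clusters.

x∈p─q⇒x∉q : ∀ {x : Fin n} (p q : Subset n) → x ∈ p ─ q → x ∉ q
x∈p─q⇒x∉q (_ ∷ p) (inside ∷ q)  (there x∈p─q) (there x∈q) = x∈p─q⇒x∉q p q x∈p─q x∈q
x∈p─q⇒x∉q (_ ∷ p) (outside ∷ q) (there x∈p─q) (there x∈q) = x∈p─q⇒x∉q p q x∈p─q x∈q

Disjoint : Subset n → Subset n → Set
Disjoint A B = Empty (A ∩ B)

Disjoint-sym : ∀ {A B : Subset n} → Disjoint A B → Disjoint B A
Disjoint-sym {A = A} {B} = subst Empty (∩-comm A B)

Disjoint-⊆ : ∀ {A A′ B : Subset n} → A′ ⊆ A → Disjoint A B → Disjoint A′ B
Disjoint-⊆ {A′ = A′} {B} A′⊆A dis (x , x∈) with x∈A′ , x∈B ← x∈p∩q⁻ A′ B x∈ =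
  dis (x , x∈p∩q⁺ (A′⊆A x∈A′ , x∈B))

Disjoint-∪ : ∀ {A B D : Subset n} → Disjoint A D → Disjoint B D → Disjoint (A ∪ B) D
Disjoint-∪ {A = A} {B} {D} disA disB (x , x∈) with x∈A∪B , x∈D ← x∈p∩q⁻ (A ∪ B) D x∈
  with x∈p∪q⁻ A B x∈A∪B
... | inj₁ x∈A = disA (x , x∈p∩q⁺ (x∈A , x∈D))
... | inj₂ x∈B = disB (x , x∈p∩q⁺ (x∈B , x∈D))

Disjoint⇒≢ : ∀ {A B : Subset n} → Nonempty A → Disjoint A B → A ≢ B
Disjoint⇒≢ (x , x∈A) dis refl = dis (x , x∈p∩q⁺ (x∈A , x∈A))

Disjoint⇒Unique : ∀ {As : List (Subset n)} → All Nonempty As → AllPairs Disjoint As → Unique As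
Disjoint⇒Unique []       []         = []
Disjoint⇒Unique (A ∷ As) (dis ∷ diss) = All.map (Disjoint⇒≢ A) dis ∷ Disjoint⇒Unique As diss

Disjoint-↭ : ∀ {As Bs : List (Subset n)} → As ↭ Bs → AllPairs Disjoint As → AllPairs Disjoint Bs
Disjoint-↭ As↭Bs = AllPairs-resp-↭ (setoid _) (λ {A} {B} → Disjoint-sym {A = A} {B})
  (resp₂ Disjoint) (↭⇒↭ₛ As↭Bs)

clusters-unique : (C : Clustering n) → Unique (clusters C)
clusters-unique C = Disjoint⇒Unique (nonempty C) (disjoint C)

∃-cluster : (C : Clustering n) (x : Fin n) → ∃[ A ] A ∈ₗ clusters C × x ∈ A
∃-cluster C x = Membership.find (covers C x)

cluster-≡ : (C : Clustering n) {A B : Subset n} {x : Fin n} →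
  A ∈ₗ clusters C → B ∈ₗ clusters C → x ∈ A → x ∈ B → A ≡ B
cluster-≡ C = go (disjoint C)
  where
  go : ∀ {Cs A B x} → AllPairs Disjoint Cs → A ∈ₗ Cs → B ∈ₗ Cs → x ∈ A → x ∈ B → A ≡ B
  go _ (here refl) (here refl) _ _ = refl
  go (dis ∷ _) (here refl) (there B∈) x∈A x∈B =
    ⊥-elim (All.lookup dis B∈ (_ , x∈p∩q⁺ (x∈A , x∈B)))
  go (dis ∷ _) (there A∈) (here refl) x∈A x∈B =
    ⊥-elim (All.lookup dis A∈ (_ , x∈p∩q⁺ (x∈B , x∈A)))
  go (_ ∷ diss) (there A∈) (there B∈) = go diss A∈ B∈

-- The filter in `replace` tests membership, not position: it drops all of `old`, and it keeps all
-- of `Cs` because no entry of `Cs` equals an old cluster.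
replace-↭ : ∀ {old Cs Ds : List (Subset n)} new → Ds ↭ old ++ Cs →
  All (λ D → ¬ (D ∈ₗ old)) Cs → replace old new Ds ↭ new ++ Cs
replace-↭ {old = old} {Cs} {Ds} new Ds↭ ∉old = ++⁺ˡ new (begin
  filter keep? Ds                      ↭⟨ filter-↭ keep? Ds↭ ⟩
  filter keep? (old ++ Cs)             ≡⟨ filter-++ keep? old Cs ⟩
  filter keep? old ++ filter keep? Cs  ≡⟨ cong₂ _++_ (filter-none keep? (All.tabulate λ D∈ D∉ → D∉ D∈))
                                                     (filter-all keep? ∉old) ⟩
  Cs                                   ∎)
  where
  open PermutationReasoning
  keep? = λ D → ¬? (D ∈ₗ? old)

-- The distance on bare lists.

meets? : (A : Subset n) → Decidable (λ B → Nonempty (B ∩ A))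
meets? A B = nonempty? (B ∩ A)

-- Stated for lists because the remainder `Cs`, with the clusters operated on removed, need not
-- cover and so is not a `Clustering`.
hitsₗ : Subset n → List (Subset n) → ℕ
hitsₗ A = count (meets? A)

distₗ : List (Subset n) → List (Subset n) → ℕ
distₗ Cs Ds = sum (map (λ A → hitsₗ A Ds ∸ 1) Cs)

distₗ-↭ˡ : ∀ {Cs Cs′ : List (Subset n)} Ds → Cs ↭ Cs′ → distₗ Cs Ds ≡ distₗ Cs′ Ds
distₗ-↭ˡ Ds Cs↭ = sum-↭ (map⁺ _ Cs↭)

-- Two parts subtract 1 twice where the whole subtracts it once, hence the extra 1. Truncation does
-- no harm, since `n` is at most `1 + (n ∸ 1)` even at zero.
m≤n+o⇒m∸1≤1+[n∸1]+[o∸1] : ∀ m n o → m ≤ n + o → m ∸ 1 ≤ suc ((n ∸ 1) + (o ∸ 1))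
m≤n+o⇒m∸1≤1+[n∸1]+[o∸1] m n o m≤n+o = begin
  m ∸ 1                                ≤⟨ ∸-monoˡ-≤ 1 m≤n+o ⟩
  n + o ∸ 1                            ≤⟨ ∸-monoˡ-≤ 1 (+-mono-≤ (m≤n+m∸n n 1) (m≤n+m∸n o 1)) ⟩
  (n ∸ 1) + suc (o ∸ 1)                ≡⟨ +-suc (n ∸ 1) (o ∸ 1) ⟩
  suc ((n ∸ 1) + (o ∸ 1))              ∎
  where open ≤-Reasoning

-- Any point of `A` lies in some target cluster `D`. Both `D` and `T` meet `A`, which meets at most
-- one target cluster, so `D` is `T`.
pure-⊆ : (C* : Clustering n) {A T : Subset n} → hits A C* ≤ 1 →
  T ∈ₗ clusters C* → Nonempty (A ∩ T) → A ⊆ T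
pure-⊆ C* {A} {T} pureA T∈ A∩T {x} x∈A with D , D∈ , x∈D ← ∃-cluster C* x =
  subst (x ∈_) D≡T x∈D
  where
  D≡T : D ≡ T
  D≡T = count≤1⇒≡ (meets? A) pureA D∈ T∈ (x , x∈p∩q⁺ (x∈D , x∈A))
                                          (subst Nonempty (∩-comm A T) A∩T)

hits≱2⇒dist≡0 : (C D : Clustering n) → All (λ A → ¬ 2 ≤ hits A D) (clusters C) → dist C D ≡ 0
hits≱2⇒dist≡0 _ _ = sum-map-0 ∘ All.map (m≤n⇒m∸n≡0 ∘ s≤s⁻¹ ∘ ≰⇒>)

module _ {n : ℕ} (C* : Clustering n) (C : Clustering n) where

  -- Splitting a cluster.

  module Split {A T : Subset n} {Cs : List (Subset n)} (C↭ : clusters C ↭ A ∷ Cs)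
               (A∩T : Nonempty (A ∩ T)) (A─T : Nonempty (A ─ T)) where

    ∈-split : ∀ {x} → x ∈ A → x ∈ A ∩ T ⊎ x ∈ A ─ T
    ∈-split {x} x∈A with x ∈? T
    ... | yes x∈T = inj₁ (x∈p∩q⁺ (x∈A , x∈T))
    ... | no  x∉T = inj₂ (x∈p∧x∉q⇒x∈p─q x∈A x∉T)

    split : Clustering n
    split .clusters = (A ∩ T) ∷ (A ─ T) ∷ Cs
    split .nonempty = A∩T ∷ A─T ∷ All.tail (All-resp-↭ C↭ (nonempty C))
    split .disjoint with dis ∷ diss ← Disjoint-↭ C↭ (disjoint C) =
      (disjoint-parts ∷ All.map (λ {D} → Disjoint-⊆ {B = D} (p∩q⊆p A T)) dis) ∷
      All.map (λ {D} → Disjoint-⊆ {B = D} (p─q⊆p A T)) dis ∷ diss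
      where
      disjoint-parts : Disjoint (A ∩ T) (A ─ T)
      disjoint-parts (x , x∈) with x∈A∩T , x∈A─T ← x∈p∩q⁻ (A ∩ T) (A ─ T) x∈ =
        x∈p─q⇒x∉q A T x∈A─T (p∩q⊆q A T x∈A∩T)
    split .covers x with Any-resp-↭ C↭ (covers C x)
    ... | there x∈Cs = there (there x∈Cs)
    ... | here  x∈A  with ∈-split x∈A
    ...   | inj₁ x∈ = here x∈
    ...   | inj₂ x∈ = there (here x∈)

    isSplit : IsSplit C A T split
    isSplit = bag-=⇒ (↭⇒∼bag (↭-sym (replace-↭ _ C↭
      (All.map (λ { A≢D (here refl) → A≢D refl }) A≢Cs))))
      where
      A≢Cs : All (A ≢_) Cs
      A≢Cs = AllPairs.head (Disjoint⇒Unique (All-resp-↭ C↭ (nonempty C)) (Disjoint-↭ C↭ (disjoint C)))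

    -- If `B` meets `A`, it meets at least one of the two parts, so the count lost with `A` is
    -- regained.
    hits-split-≤ : ∀ B → hits B C ≤ hits B split
    hits-split-≤ B rewrite count-↭ (meets? B) C↭ with nonempty? (A ∩ B)
    ... | no _ = ≤-trans (count-≤-∷ (meets? B) (A ─ T) Cs) (count-≤-∷ (meets? B) (A ∩ T) _)
    ... | yes (x , x∈) with x∈A , x∈B ← x∈p∩q⁻ A B x∈ with ∈-split x∈A
    ...   | inj₁ x∈A∩T = begin
      suc (hitsₗ B Cs)         ≤⟨ s≤s (count-≤-∷ (meets? B) (A ─ T) Cs) ⟩
      suc (hitsₗ B ((A ─ T) ∷ Cs)) ≡⟨ count-accept (meets? B) (A ∩ T) _ (x , x∈p∩q⁺ (x∈A∩T , x∈B)) ⟨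
      hits B split             ∎
      where open ≤-Reasoning
    ...   | inj₂ x∈A─T = begin
      suc (hitsₗ B Cs)           ≡⟨ count-accept (meets? B) (A ─ T) Cs (x , x∈p∩q⁺ (x∈A─T , x∈B)) ⟨
      hitsₗ B ((A ─ T) ∷ Cs)       ≤⟨ count-≤-∷ (meets? B) (A ∩ T) _ ⟩
      hits B split               ∎
      where open ≤-Reasoning

    hits-parts : hits A C* ≤ hits (A ∩ T) C* + hits (A ─ T) C*
    hits-parts = count-⊎ (meets? A) (meets? (A ∩ T)) (meets? (A ─ T)) (λ {B} → meets-part {B}) (clusters C*)
      where
      meets-part : ∀ {B} → Nonempty (B ∩ A) → Nonempty (B ∩ (A ∩ T)) ⊎ Nonempty (B ∩ (A ─ T))
      meets-part {B} (x , x∈) with x∈B , x∈A ← x∈p∩q⁻ B A x∈ with ∈-split x∈A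
      ... | inj₁ x∈A∩T = inj₁ (x , x∈p∩q⁺ (x∈B , x∈A∩T))
      ... | inj₂ x∈A─T = inj₂ (x , x∈p∩q⁺ (x∈B , x∈A─T))

    -- The underclustering term cannot fall, because no target cluster loses a hit. The
    -- overclustering term falls by at most 1, because the hits of `A` are divided among its two
    -- parts.
    δ-split : δ C C* ≤ suc (δ split C*)
    δ-split = begin
      dist C* C + dist C C*           ≤⟨ +-mono-≤ under over ⟩
      dist C* split + suc (dist split C*) ≡⟨ +-suc (dist C* split) _ ⟩
      suc (δ split C*)                ∎
      where
      open ≤-Reasoning
      under : dist C* C ≤ dist C* split
      under = sum-map-mono (clusters C*) λ {B} _ → ∸-monoˡ-≤ 1 (hits-split-≤ B)
      h : Subset n → ℕ
      h B = hits B C* ∸ 1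
      rest = distₗ Cs (clusters C*)
      over : dist C C* ≤ suc (dist split C*)
      over = begin
        dist C C*                                  ≡⟨ distₗ-↭ˡ (clusters C*) C↭ ⟩
        h A + rest                                 ≤⟨ +-monoˡ-≤ rest
          (m≤n+o⇒m∸1≤1+[n∸1]+[o∸1] (hits A C*) (hits (A ∩ T) C*) (hits (A ─ T) C*) hits-parts) ⟩
        suc (h (A ∩ T) + h (A ─ T) + rest)         ≡⟨ cong suc (+-assoc (h (A ∩ T)) (h (A ─ T)) rest) ⟩
        suc (dist split C*)                        ∎

  -- Merging two clusters inside one target cluster.

  module Merge {A B T : Subset n} {Cs : List (Subset n)} (C↭ : clusters C ↭ A ∷ B ∷ Cs)
               (T∈ : T ∈ₗ clusters C*) (A⊆T : A ⊆ T) (B⊆T : B ⊆ T)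
               (pureA : hits A C* ≤ 1) (pureB : hits B C* ≤ 1) where

    nonemptyᴹ : All Nonempty (A ∷ B ∷ Cs)
    nonemptyᴹ = All-resp-↭ C↭ (nonempty C)

    disjointᴹ : AllPairs Disjoint (A ∷ B ∷ Cs)
    disjointᴹ = Disjoint-↭ C↭ (disjoint C)

    A∪B : Nonempty (A ∪ B)
    A∪B with x , x∈A ← All.head nonemptyᴹ = x , x∈p∪q⁺ (inj₁ x∈A)

    merge : Clustering n
    merge .clusters = (A ∪ B) ∷ Cs
    merge .nonempty = A∪B ∷ All.tail (All.tail nonemptyᴹ)
    merge .disjoint with (_ ∷ disA) ∷ disB ∷ diss ← disjointᴹ =
      All.zipWith (λ {D} (a , b) → Disjoint-∪ {A = A} {B} {D} a b) (disA , disB) ∷ diss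
    merge .covers x with Any-resp-↭ C↭ (covers C x)
    ... | here x∈A           = here (x∈p∪q⁺ (inj₁ x∈A))
    ... | there (here x∈B)   = here (x∈p∪q⁺ (inj₂ x∈B))
    ... | there (there x∈Cs) = there x∈Cs

    isMerge : IsMerge C A B merge
    isMerge with (_ ∷ A≢) ∷ B≢ ∷ _ ← Disjoint⇒Unique nonemptyᴹ disjointᴹ =
      bag-=⇒ (↭⇒∼bag (↭-sym (replace-↭ _ C↭ (All.zipWith
        (λ { (A≢D , _) (here refl) → A≢D refl
           ; (_ , B≢D) (there (here refl)) → B≢D refl }) (A≢ , B≢)))))

    -- The nonempty `E` inside `T` meets `T`, which uses up the single target cluster it may meet.
    only-T : ∀ {E D} → Nonempty E → E ⊆ T → hits E C* ≤ 1 →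
      D ∈ₗ clusters C* → D ≢ T → ¬ Nonempty (E ∩ D)
    only-T {E} {D} (x , x∈E) E⊆T pureE D∈ D≢T meets =
      D≢T (count≤1⇒≡ (meets? E) pureE D∈ T∈ (subst Nonempty (∩-comm E D) meets)
                                    (x , x∈p∩q⁺ (E⊆T x∈E , x∈E)))

    -- `A` and `B` account for at most two hits, and their union still accounts for one.
    hits-T : hits T C ≤ suc (hits T merge)
    hits-T = begin
      hits T C                       ≡⟨ count-↭ (meets? T) C↭ ⟩
      hitsₗ T (A ∷ B ∷ Cs)           ≤⟨ count-∷-≤ (meets? T) A _ ⟩
      suc (hitsₗ T (B ∷ Cs))         ≤⟨ s≤s (count-∷-≤ (meets? T) B Cs) ⟩
      suc (suc (hitsₗ T Cs))         ≡⟨ cong suc (count-accept (meets? T) (A ∪ B) Cs A∪B∩T) ⟨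
      suc (hits T merge)             ∎
      where
      open ≤-Reasoning
      A∪B∩T : Nonempty ((A ∪ B) ∩ T)
      A∪B∩T with x , x∈A ← All.head nonemptyᴹ = x , x∈p∩q⁺ (x∈p∪q⁺ (inj₁ x∈A) , A⊆T x∈A)

    hits-≢T : ∀ {D} → D ∈ₗ clusters C* → D ≢ T → hits D C ≤ hits D merge
    hits-≢T {D} D∈ D≢T = begin
      hits D C               ≡⟨ count-↭ (meets? D) C↭ ⟩
      hitsₗ D (A ∷ B ∷ Cs)   ≡⟨ count-reject (meets? D) A _ (only-T (All.head nonemptyᴹ) A⊆T pureA D∈ D≢T) ⟩
      hitsₗ D (B ∷ Cs)       ≡⟨ count-reject (meets? D) B Cs (only-T (All.head (All.tail nonemptyᴹ)) B⊆T pureB D∈ D≢T) ⟩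
      hitsₗ D Cs             ≤⟨ count-≤-∷ (meets? D) (A ∪ B) Cs ⟩
      hits D merge           ∎
      where open ≤-Reasoning

    -- Only the summand of `T` in the underclustering term can fall, and by at most 1, since `A` and
    -- `B` meet no other target cluster. The overclustering term cannot fall, since `A` and `B`
    -- contribute nothing to it.
    δ-merge : δ C C* ≤ suc (δ merge C*)
    δ-merge = +-mono-≤ under over
      where
      open ≤-Reasoning
      hits-T-∸ : hits T C ∸ 1 ≤ suc (hits T merge ∸ 1)
      -- The second inequality covers the truncated case, where `hits T merge` would be 0.
      hits-T-∸ = ≤-trans (∸-monoˡ-≤ 1 hits-T) (m≤n+m∸n (hits T merge) 1)
      under : dist C* C ≤ suc (dist C* merge)
      under = sum-map-mono-but-one (clusters-unique C*) hits-T-∸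
        (λ D∈ D≢T → ∸-monoˡ-≤ 1 (hits-≢T D∈ D≢T)) T∈
      rest = distₗ Cs (clusters C*)
      over : dist C C* ≤ dist merge C*
      over = begin
        dist C C*                                  ≡⟨ distₗ-↭ˡ (clusters C*) C↭ ⟩
        (hits A C* ∸ 1) + ((hits B C* ∸ 1) + rest) ≡⟨ cong₂ (λ a b → a + (b + rest))
                                                        (m≤n⇒m∸n≡0 pureA) (m≤n⇒m∸n≡0 pureB) ⟩
        rest                                       ≤⟨ m≤n+m rest (hits (A ∪ B) C* ∸ 1) ⟩
        dist merge C*                              ∎

  -- Choosing an operation, and the induction on `γ`.

  module _ {γ : Clustering n → ℕ} (natural : IsNaturalError C* γ) where
    open IsNaturalError natural

    -- `δ` is bounded only from one side: it need not decrease, since the strict decrease of `γ`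
    -- drives the induction.
    Improvement : Set
    Improvement = ∃[ C′ ] γ C′ < γ C × δ C C* ≤ suc (δ C′ C*)

    improve-by-split : ∀ {A} → A ∈ₗ clusters C → 2 ≤ hits A C* → Improvement
    improve-by-split {A} A∈ 2≤hits
      with T , S , (T∈ , T∩A) , (S∈ , x , x∈S∩A) , T≢S ← 2≤count⇒∃₂ (meets? A) (clusters-unique C*) 2≤hits
      with x∈S , x∈A ← x∈p∩q⁻ S A x∈S∩A
      with Cs , C↭ ← toFront A∈ =
      split , split-decreases A∈ T∈ A∩T (S , S∈ , T≢S ∘ sym , x , x∈p∩q⁺ (x∈A , x∈S)) isSplit , δ-split
      where
      A∩T = subst Nonempty (∩-comm T A) T∩A
      -- The second target cluster `S` shows that `A ─ T` is nonempty: the point `x` of `A` and `S`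
      -- cannot lie in `T`, as target clusters sharing a point are equal.
      open Split C↭ A∩T (x , x∈p∧x∉q⇒x∈p─q x∈A λ x∈T → T≢S (cluster-≡ C* T∈ S∈ x∈T x∈S))

    -- Purity is what turns meeting `T` into lying inside `T`, as a natural merge requires.
    improve-by-merge : All (λ A → hits A C* ≤ 1) (clusters C) →
      ∀ {T} → T ∈ₗ clusters C* → 2 ≤ hits T C → Improvement
    improve-by-merge pure {T} T∈ 2≤hits
      with A , B , (A∈ , A∩T) , (B∈ , B∩T) , A≢B ← 2≤count⇒∃₂ (meets? T) (clusters-unique C) 2≤hits
      with Ds , C↭Ds ← toFront A∈
      with ∈-resp-↭ C↭Ds B∈
    ... | here B≡A = ⊥-elim (A≢B (sym B≡A))
    ... | there B∈Ds with Cs , Ds↭ ← toFront B∈Ds =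
      merge , merge-decreases A∈ B∈ A≢B (T , T∈ , A⊆T , B⊆T) isMerge , δ-merge
      where
      A⊆T : A ⊆ T
      A⊆T = pure-⊆ C* (All.lookup pure A∈) T∈ A∩T
      B⊆T : B ⊆ T
      B⊆T = pure-⊆ C* (All.lookup pure B∈) T∈ B∩T
      open Merge (↭-trans C↭Ds (↭-prep A Ds↭)) T∈ A⊆T B⊆T (All.lookup pure A∈) (All.lookup pure B∈)

    -- Splits are tried first, so that every cluster is known to be pure when a merge is sought.
    -- When neither applies, every `hits` is at most 1 and each summand of both distances vanishes.
    improve : δ C C* ≡ 0 ⊎ Improvement
    improve with any? (λ A → 2 ≤? hits A C*) (clusters C)
    ... | yes impure with A , A∈ , 2≤ ← Membership.find impure = inj₂ (improve-by-split A∈ 2≤)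
    ... | no  ¬impure with any? (λ T → 2 ≤? hits T C) (clusters C*)
    ...   | yes broken with T , T∈ , 2≤ ← Membership.find broken =
      inj₂ (improve-by-merge (All.map (s≤s⁻¹ ∘ ≰⇒>) (¬Any⇒All¬ _ ¬impure)) T∈ 2≤)
    ...   | no  ¬broken =
      inj₁ (cong₂ _+_ (hits≱2⇒dist≡0 C* C (¬Any⇒All¬ _ ¬broken))
                      (hits≱2⇒dist≡0 C C* (¬Any⇒All¬ _ ¬impure)))

theorem8 : ∀ (n : ℕ) (C* : Clustering n) (γ : Clustering n → ℕ) →
    IsNaturalError C* γ → ∀ (C : Clustering n) → γ C ≥ δ C C*
theorem8 n C* γ natural C = go C (<-wellFounded (γ C))
  where
  go : ∀ C → Acc _<_ (γ C) → γ C ≥ δ C C*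
  go C (acc rec) with improve C* C natural
  ... | inj₁ δ≡0 = subst (_≤ γ C) (sym δ≡0) z≤n
  -- The chain is `δ C C* ≤ suc (δ C′ C*) ≤ suc (γ C′) ≤ γ C`, the last step being the strict
  -- decrease of `γ`.
  ... | inj₂ (C′ , γ< , δ≤) = ≤-trans δ≤ (≤-trans (s≤s (go C′ (rec γ<))) γ<)
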